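{- There is no polynomial $\mathbf{ResSV}$ proof $\mathit{PHP}\vdash_{\mathbf{ResSV}}\{(\Box,\infty)\}$; that is, there is no family of $\mathbf{ResSV}$ proofs of $\{(\Box,\infty)\}$ from $\mathit{PHP}_m$ whose lengths are bounded by a polynomial in $m$.
   Context: A literal is a Boolean variable $x$ or its negation $\overline x$; a clause is a disjunction of literals ($\Box$ is the empty clause). Weights are elements of $\mathbb{R}_{>0}\cup\{\infty\}$ with $\infty+w=\infty-w=\infty$; during $\mathbf{ResSV}$ proofs clauses may also carry finite negative weights. A MaxSAT formula is a finite collection of weighted clauses $(C,w)$, where $(C,u),(C,v)$ may be merged into $(C,u+v)$ and conversely, and clauses of weight $0$ disappear. $\mathcal G\subseteq\mathcal F$ means every $(C,w)\in\mathcal G$ has some $(C,w')\in\mathcal F$ with $w\le w'$. A MaxSAT inference rule replaces its antecedents in the current formula by its consequents. A proof is a sequence $\mathcal F_0;\dots;\mathcal F_e$ (length $e$), each obtained from the previous by one rule application; $\mathcal F\vdash_{\mathbf{ResSV}}\mathcal G$ means there is such a proof with $\mathcal F_0=\mathcal F$, $\mathcal G\subseteq\mathcal F_e$ and all clauses of $\mathcal F_e$ having positive weight. $\mathbf{ResSV}$ rules: Resolution: from $(x\lor A,v),(\overline x\lor B,w)$ with $v,w$ positive ($A,B$ possibly empty), with $m=\min\{v,w\}$, derive $(A\lor B,m),(x\lor A,v-m),(\overline x\lor B,w-m),(x\lor A\lor\overline B,m),(\overline x\lor B\lor\overline A,m)$, where for $D=l_1\lor\dots\lor l_p$ the expression $(E\lor\overline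 D,u)$ stands for $(E\lor\overline{l_1},u),(E\lor l_1\lor\overline{l_2},u),\dots,(E\lor l_1\lor\dots\lor l_{p-1}\lor\overline{l_p},u)$ (nothing if $D$ is empty), and tautologies are discarded. Split: from $(A,w)$ with $w$ positive derive $(A\lor x,w),(A\lor\overline x,w)$. Virtual: with no antecedents, introduce $(A,w),(A,-w)$ for any clause $A$ and finite $w$. Pigeon hole problem: for $m\ge1$ take variables $x_{ij}$, $1\le i\le m+1$, $1\le j\le m$; let $\mathcal K_m$ consist of the clauses $x_{i1}\lor\dots\lor x_{im}$ for each $i$ and $\overline x_{ij}\lor\overline x_{i'j}$ for each $j$ and $1\le i<i'\le m+1$. $\mathit{PHP}_m=\{(C,\infty)\mid C\in\mathcal K_m\}$. -}

module Defs where

open import Data.Nat as ℕ using (ℕ; zero; suc; _≤_; _^_; _*_; _∸_)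
import Data.Nat.Properties as ℕP
open import Data.Product using (Σ; ∃; ∃-syntax; _×_; _,_; proj₁; proj₂)
import Data.Product.Properties as ×P
open import Data.List using (List; []; _∷_; _++_; [_]; map; concatMap; filter; upTo)
open import Data.List.Membership.Propositional using (_∈_)
open import Data.List.Relation.Unary.All using (All)
open import Data.List.Relation.Unary.Any using (any?)
open import Data.Unit using (⊤)
open import Relation.Binary.PropositionalEquality using (_≡_; refl; cong)
open import Relation.Binary.Structures using (IsStrictTotalOrder)
open import Relation.Binary.Definitions using (DecidableEquality; tri<; tri≈; tri>)
open import Relation.Binary.Construct.Closure.Equivalence using (EqClosure)
open import Algebra.Structures using (IsAbelianGroup)
open import Relation.Nullary using (¬_; Dec; yes; no; ¬?)

-- Weights.  Finite weights live in a linearly ordered abelian group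
-- (the paper uses ℝ, which is an instance).

record OrderedAbelianGroup : Set₁ where
  infixl 6 _+_
  field
    Carrier            : Set
    _+_                : Carrier → Carrier → Carrier
    𝟘                  : Carrier
    -_                 : Carrier → Carrier
    _<_                : Carrier → Carrier → Set
    isAbelianGroup     : IsAbelianGroup _≡_ _+_ 𝟘 -_
    isStrictTotalOrder : IsStrictTotalOrder _≡_ _<_
    +-mono-<           : ∀ {a b} c → a < b → (a + c) < (b + c)

-- variable x_{ij} is the pair (i , j)
Var : Set
Var = ℕ × ℕ

data Lit : Set where
  pos : Var → Lit
  neg : Var → Lit

compl : Lit → Lit
compl (pos x) = neg x
compl (neg x) = pos x

_≟V_ : DecidableEquality Var
_≟V_ = ×P.≡-dec ℕP._≟_ ℕP._≟_

_≟L_ : DecidableEquality Lit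
pos x ≟L pos y with x ≟V y
... | yes refl = yes refl
... | no ne = no λ { refl → ne refl }
pos x ≟L neg y = no λ ()
neg x ≟L pos y = no λ ()
neg x ≟L neg y with x ≟V y
... | yes refl = yes refl
... | no ne = no λ { refl → ne refl }

-- a clause is a disjunction of literals; [] is the empty clause □
Clause : Set
Clause = List Lit

-- clauses are identified up to their set of literals
SameLits : Clause → Clause → Set
SameLits C D = (∀ {l} → l ∈ C → l ∈ D) × (∀ {l} → l ∈ D → l ∈ C)

open import Data.List.Membership.DecPropositional _≟L_ using (_∈?_)

Tautology : Clause → Set
Tautology C = Data.List.Relation.Unary.Any.Any (λ l → compl l ∈ C) C

tautology? : (C : Clause) → Dec (Tautology C)
tautology? C = any? (λ l → compl l ∈? C) C

-- (E ∨ D̄) for D = l₁ ∨ … ∨ l_p :  E ∨ l̄₁ , E ∨ l₁ ∨ l̄₂ , … , E ∨ l₁ ∨ … ∨ l_{p-1} ∨ l̄_p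
negCl : Clause → Clause → List Clause
negCl E []      = []
negCl E (l ∷ D) = (E ++ [ compl l ]) ∷ negCl (E ++ [ l ]) D

holes : ℕ → List ℕ
holes m = map suc (upTo m)

pigeons : ℕ → List ℕ
pigeons m = map suc (upTo (suc m))

pigeonClause : ℕ → ℕ → Clause
pigeonClause m i = map (λ j → pos (i , j)) (holes m)

holeClauses : ℕ → List Clause
holeClauses m =
  concatMap (λ j →
    concatMap (λ i →
      map (λ k → neg (i , j) ∷ neg (i ℕ.+ suc k , j) ∷ [])
          (upTo (suc m ∸ i)))
      (pigeons m))
    (holes m)

K : ℕ → List Clause
K m = map (pigeonClause m) (pigeons m) ++ holeClauses m

module ResSV (G : OrderedAbelianGroup) where
  open OrderedAbelianGroup G

  compare = IsStrictTotalOrder.compare isStrictTotalOrder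

  data Wt : Set where
    fin : Carrier → Wt
    ∞   : Wt

  Positive : Wt → Set
  Positive (fin a) = 𝟘 < a
  Positive ∞       = ⊤

  _⊕_ : Wt → Wt → Wt
  fin a ⊕ fin b = fin (a + b)
  fin a ⊕ ∞     = ∞
  ∞     ⊕ _     = ∞

  -- v ⊖ m, only used with m = min v w (so m finite whenever v is)
  _⊖_ : Wt → Wt → Wt
  fin a ⊖ fin b = fin (a + (- b))
  fin a ⊖ ∞     = ∞
  ∞     ⊖ _     = ∞

  minW : Wt → Wt → Wt
  minW (fin a) (fin b) with compare a b
  ... | tri< _ _ _ = fin a
  ... | tri≈ _ _ _ = fin a
  ... | tri> _ _ _ = fin b
  minW (fin a) ∞ = fin a
  minW ∞ w       = w

  WClause : Set
  WClause = Clause × Wt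

  -- a MaxSAT formula, as a list of weighted clauses (a representative of
  -- the collection; see _≈F_ below)
  Formula : Set
  Formula = List WClause

  data Basic : Formula → Formula → Set where
    swap    : ∀ a b R → Basic (a ∷ b ∷ R) (b ∷ a ∷ R)
    merge   : ∀ C u v R → Basic ((C , u) ∷ (C , v) ∷ R) ((C , u ⊕ v) ∷ R)
    zeroW   : ∀ C R → Basic ((C , fin 𝟘) ∷ R) R
    relabel : ∀ C D w R → SameLits C D → Basic ((C , w) ∷ R) ((D , w) ∷ R)
    there   : ∀ a {F F'} → Basic F F' → Basic (a ∷ F) (a ∷ F')

  _≈F_ : Formula → Formula → Set
  _≈F_ = EqClosure Basic

  dropTaut : List WClause → List WClause
  dropTaut = filter (λ c → ¬? (tautology? (proj₁ c)))

  withW : Wt → List Clause → List WClause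
  withW u = map (λ C → (C , u))

  resolvents : Var → Clause → Clause → Wt → Wt → Formula
  resolvents x A B v w =
    let m = minW v w in
    dropTaut ( (A ++ B , m)
             ∷ (pos x ∷ A , v ⊖ m)
             ∷ (neg x ∷ B , w ⊖ m)
             ∷ (withW m (negCl (pos x ∷ A) B) ++ withW m (negCl (neg x ∷ B) A)))

  data Rule : Formula → Formula → Set where
    resolution : ∀ x A B v w → Positive v → Positive w →
                 Rule ((pos x ∷ A , v) ∷ (neg x ∷ B , w) ∷ [])
                      (resolvents x A B v w)
    split      : ∀ A w x → Positive w →
                 Rule ((A , w) ∷ [])
                      ((A ++ [ pos x ] , w) ∷ (A ++ [ neg x ] , w) ∷ [])
    virtual    : ∀ A a →
                 Rule [] ((A , fin a) ∷ (A , fin (- a)) ∷ [])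

  Step : Formula → Formula → Set
  Step F F' = ∃[ Ant ] ∃[ Con ] ∃[ R ]
                (F ≈F (Ant ++ R)) × Rule Ant Con × (F' ≈F (Con ++ R))

  data Proof : ℕ → Formula → Formula → Set where
    done : ∀ {F} → Proof zero F F
    step : ∀ {e F F' F''} → Step F F' → Proof e F' F'' → Proof (suc e) F F''

  RefutesIn : ℕ → Formula → Set
  RefutesIn e F = ∃[ Fe ] Proof e F Fe ×
                  ∃[ F' ] (Fe ≈F F') × All (λ c → Positive (proj₂ c)) F'
                                     × (([] , ∞) ∈ F')

  PHP : ℕ → Formula
  PHP m = withW ∞ (K m)

  -- a family of proofs of {(□,∞)} from PHP_m, m ≥ 1, of length
  -- bounded by a polynomial in m (w.l.o.g. of the form c·m^k + c)
  PolynomialPHPProofs : Set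
  PolynomialPHPProofs =
    ∃[ c ] ∃[ k ] ∀ m → 1 ≤ m →
      ∃[ e ] (e ≤ c * m ^ k ℕ.+ c) × RefutesIn e (PHP m)

{-# OPTIONS --safe #-}

-- Infinite weights arise only from infinite weights, so the clauses of infinite
-- weight occurring in a proof of (□, ∞) form a resolution refutation (with
-- weakening) of the pigeon hole clauses, with at most one resolvent per step.
-- It remains to bound resolution from below as Haken does, in the style of Beame
-- and Pitassi.  Put m = 2n.  Greedily place n pigeons, each time choosing the pair
-- (pigeon, hole) whose variable occurs in the monotone forms of most of the wide
-- resolvents still unsatisfied: each choice satisfies at least 1/36 of them, so
-- fewer than (36/35)ⁿ resolvents leave no wide one.  On the n + 1 pigeons left,
-- consider for each clause the pigeons i such that some assignment leaving out
-- only i falsifies it.  Their number is at most 1 for the pigeon hole clauses,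
-- n + 1 for □, and subadditive under resolution; hence it lies between a third and
-- two thirds for some resolvent, which forces that resolvent to be wide.

module Submission where

open import Defs
open import Data.Bool using (Bool; true; false; not; _∧_)
open import Data.Empty using (⊥)
open import Data.List using (List; []; _∷_; _++_; [_]; length; map; filter; upTo)
open import Data.List.Membership.Propositional using (_∈_; _∉_; find; lose)
open import Data.List.Membership.Propositional.Properties using (∈-++⁺ˡ; ∈-∃++; ∈-filter⁺; ∈-map⁺)
open import Data.List.Properties using (length-map; length-upTo; length-filter)
open import Data.List.Relation.Binary.Permutation.Propositional using (_↭_; ↭-sym; ↭⇒↭ₛ)
open import Data.List.Relation.Binary.Permutation.Propositional.Properties using (shift; ↭-length; ∈-resp-↭; map⁺)
open import Data.List.Relation.Binary.Permutation.Setoid.Properties using (Unique-resp-↭)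
open import Data.List.Relation.Binary.Subset.Propositional using (_⊆_)
open import Data.List.Relation.Unary.All using (All; []; _∷_)
import Data.List.Relation.Unary.All as All
import Data.List.Relation.Unary.All.Properties as All
open import Data.List.Relation.Unary.AllPairs using ([]; _∷_)
open import Data.List.Relation.Unary.Any using (Any; here; there; any?)
import Data.List.Relation.Unary.Any as Any
import Data.List.Relation.Unary.Any.Properties as Any
open import Data.List.Relation.Unary.Unique.Propositional using (Unique)
import Data.List.Relation.Unary.Unique.Propositional.Properties as Unique
open import Data.Nat using (ℕ; zero; suc; _+_; _*_; _∸_; _^_; _≤_; _<_; z≤n; s≤s; s≤s⁻¹; NonZero)
open import Data.Nat.ListAction using (sum)
open import Data.Nat.ListAction.Properties using (sum-↭)
open import Data.Nat.Properties
open import Data.Nat.Tactic.RingSolver using (solve-∀)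
open import Data.Product using (∃-syntax; _×_; _,_; proj₁; proj₂)
open import Data.Sum using (_⊎_; inj₁; inj₂)
open import Data.Unit using (tt)
open import Function using (_∘_)
open import Relation.Binary.Construct.Closure.ReflexiveTransitive using (ε; _◅_)
import Relation.Binary.Construct.Closure.Equivalence as Eq
open import Relation.Binary.Construct.Closure.Symmetric using (fwd; bwd)
open import Relation.Binary.Definitions using (tri<; tri≈; tri>)
open import Relation.Binary.PropositionalEquality using (_≡_; _≢_; refl; sym; trans; cong; cong₂; subst; subst₂; setoid)
open import Relation.Nullary using (¬_; Dec; yes; no; does; contradiction; ¬?)
open import Relation.Nullary.Decidable using (_×-dec_; dec-true; dec-false; decidable-stable)
open import Relation.Unary using (Pred; Decidable)

private variable
  A B : Set

-- Exponential versus polynomial growth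

n<2^n : ∀ n → n < 2 ^ n
n<2^n zero    = s≤s z≤n
n<2^n (suc n) = begin
  1 + suc n        ≤⟨ +-mono-≤ (m^n>0 2 n) (n<2^n n) ⟩
  2 ^ n + 2 ^ n    ≡⟨ cong (2 ^ n +_) (+-identityʳ (2 ^ n)) ⟨
  2 ^ suc n        ∎
  where open ≤-Reasoning

[4+n]²≤2^[4+n] : ∀ n → (4 + n) * (4 + n) ≤ 2 ^ (4 + n)
[4+n]²≤2^[4+n] zero    = ≤-refl
[4+n]²≤2^[4+n] (suc n) = begin
  (5 + n) * (5 + n)                         ≤⟨ m≤m+n _ (7 + 6 * n + n * n) ⟩
  (5 + n) * (5 + n) + (7 + 6 * n + n * n)   ≡⟨ identity n ⟩
  2 * ((4 + n) * (4 + n))                   ≤⟨ *-monoʳ-≤ 2 ([4+n]²≤2^[4+n] n) ⟩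
  2 ^ (5 + n)                               ∎
  where
  open ≤-Reasoning
  identity : ∀ n → (5 + n) * (5 + n) + (7 + 6 * n + n * n) ≡ 2 * ((4 + n) * (4 + n))
  identity = solve-∀

^-distribʳ-* : ∀ a b n → (a * b) ^ n ≡ a ^ n * b ^ n
^-distribʳ-* a b zero    = refl
^-distribʳ-* a b (suc n) = trans (cong (a * b *_) (^-distribʳ-* a b n)) (interchange a b (a ^ n) (b ^ n))
  where
  interchange : ∀ a b c d → a * b * (c * d) ≡ a * c * (b * d)
  interchange = solve-∀

-- If the ratio of `a` to `b` at least doubles over `d` factors, then over `d * s` factors it
-- doubles `s` times.
exponential-ratio : ∀ a b d s → 2 * b ^ d ≤ a ^ d → 2 ^ s * b ^ (d * s) ≤ a ^ (d * s)
exponential-ratio a b d s 2bᵈ≤aᵈ = begin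
  2 ^ s * b ^ (d * s)    ≡⟨ cong (2 ^ s *_) (^-*-assoc b d s) ⟨
  2 ^ s * (b ^ d) ^ s    ≡⟨ ^-distribʳ-* 2 (b ^ d) s ⟨
  (2 * b ^ d) ^ s        ≤⟨ ^-monoˡ-≤ s 2bᵈ≤aᵈ ⟩
  (a ^ d) ^ s            ≡⟨ ^-*-assoc a d s ⟩
  a ^ (d * s)            ∎
  where open ≤-Reasoning

-- With `M` bounding `m ^ k`, the left side is at most `c * (2 * M)`. The factor `c` costs at most
-- `c` in the exponent and the factor 2 costs one more.
polynomial<2^ : ∀ c k r m p → m ≤ 2 ^ (7 + r) → c + suc ((7 + r) * k) ≤ p → c * m ^ k + c < 2 ^ p
polynomial<2^ c k r m p m≤ exponent = begin-strict
  c * m ^ k + c                          ≤⟨ +-mono-≤ (*-monoʳ-≤ c base) (m≤m*n c M) ⟩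
  c * M + c * M                          ≡⟨ double c M ⟩
  c * (2 * M)                            <⟨ *-monoˡ-< (2 * M) {{m*n≢0 2 M}} (n<2^n c) ⟩
  2 ^ c * 2 ^ suc ((7 + r) * k)          ≡⟨ ^-distribˡ-+-* 2 c (suc ((7 + r) * k)) ⟨
  2 ^ (c + suc ((7 + r) * k))            ≤⟨ ^-monoʳ-≤ 2 exponent ⟩
  2 ^ p                                  ∎
  where
  open ≤-Reasoning
  M : ℕ
  M = 2 ^ ((7 + r) * k)
  instance
    M≢0 : NonZero M
    M≢0 = m^n≢0 2 ((7 + r) * k)
  double : ∀ c M → c * M + c * M ≡ c * (2 * M)
  double = solve-∀
  base : m ^ k ≤ M
  base = ≤-trans (^-monoˡ-≤ k m≤) (≤-reflexive (^-*-assoc 2 (7 + r) k))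

linear≤2^ : ∀ c k → ∃[ r ] c + suc ((7 + r) * k) ≤ 2 ^ r
-- For r = 4 + c + 7k the left side is at most r * r, and r ≥ 4 puts r * r below 2 ^ r.
linear≤2^ c k = 4 + q , (begin
  c + suc ((7 + (4 + q)) * k)                                        ≤⟨ m≤m+n _ (3 + (4 + q) * (3 + (c + 6 * k))) ⟩
  c + suc ((7 + (4 + q)) * k) + (3 + (4 + q) * (3 + (c + 6 * k)))    ≡⟨ square c k ⟩
  (4 + q) * (4 + q)                                                  ≤⟨ [4+n]²≤2^[4+n] q ⟩
  2 ^ (4 + q)                                                        ∎)
  where
  open ≤-Reasoning
  q : ℕ
  q = c + 7 * k
  square : ∀ c k → c + suc ((7 + (4 + (c + 7 * k))) * k) + (3 + (4 + (c + 7 * k)) * (3 + (c + 6 * k)))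
                   ≡ (4 + (c + 7 * k)) * (4 + (c + 7 * k))
  square = solve-∀

-- The choice n = d * 2 ^ r makes the ratio of the powers at least 2 ^ (2 ^ r). Since d ≤ 2 ^ 6, 2n
-- stays below 2 ^ (7 + r), so the polynomial has an exponent linear in r.
exponential-ratio-beats-polynomial : ∀ a b d .{{_ : NonZero b}} →
  3 ≤ d → d ≤ 2 ^ 6 → 2 * b ^ d ≤ a ^ d → ∀ c k →
  ∃[ n ] 3 ≤ n × b ^ n * (c * (2 * n) ^ k + c) < a ^ n
exponential-ratio-beats-polynomial a b d 3≤d d≤64 ratio c k = n , ≤-trans 3≤d (m≤m*n d (2 ^ r) {{m^n≢0 2 r}}) , (begin-strict
  b ^ n * (c * (2 * n) ^ k + c)  <⟨ *-monoʳ-< (b ^ n) {{m^n≢0 b n}} (polynomial<2^ c k r (2 * n) (2 ^ r) 2n≤ (proj₂ (linear≤2^ c k))) ⟩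
  b ^ n * 2 ^ (2 ^ r)            ≡⟨ *-comm (b ^ n) (2 ^ (2 ^ r)) ⟩
  2 ^ (2 ^ r) * b ^ n            ≤⟨ exponential-ratio a b d (2 ^ r) ratio ⟩
  a ^ n                          ∎)
  where
  open ≤-Reasoning
  r n : ℕ
  r = proj₁ (linear≤2^ c k)
  n = d * 2 ^ r
  2n≤ : 2 * n ≤ 2 ^ (7 + r)
  2n≤ = *-monoʳ-≤ 2 (≤-trans (*-monoˡ-≤ (2 ^ r) d≤64) (≤-reflexive (sym (^-distribˡ-+-* 2 6 r))))

exponential-beats-polynomial : ∀ c k →
  ∃[ n ] 3 ≤ n × 35 ^ n * (c * (2 * n) ^ k + c) < 36 ^ n
exponential-beats-polynomial =
  -- The third argument is 35 because (1 + 1/35)^35 ≥ 2 by Bernoulli's inequality; here the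
  -- inequality is evaluated.
  exponential-ratio-beats-polynomial 36 35 35 (m≤m+n 3 32) (m≤m+n 35 29)
    (≤ᵇ⇒≤ (2 * 35 ^ 35) (36 ^ 35) tt)

-- Finite sums and counting

∑ : List A → (A → ℕ) → ℕ
∑ xs f = sum (map f xs)

χ : Bool → ℕ
χ true  = 1
χ false = 0

∑-0 : (xs : List A) → ∑ xs (λ _ → 0) ≡ 0
∑-0 []       = refl
∑-0 (x ∷ xs) = ∑-0 xs

∑-distrib-+ : (xs : List A) (f g : A → ℕ) → ∑ xs (λ x → f x + g x) ≡ ∑ xs f + ∑ xs g
∑-distrib-+ []       f g = refl
∑-distrib-+ (x ∷ xs) f g =
  trans (cong (f x + g x +_) (∑-distrib-+ xs f g)) (interchange (f x) (g x) _ _)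
  where
  interchange : ∀ a b c d → (a + b) + (c + d) ≡ (a + c) + (b + d)
  interchange = solve-∀

∑-comm : (xs : List A) (ys : List B) (f : A → B → ℕ) →
         ∑ xs (λ x → ∑ ys (f x)) ≡ ∑ ys (λ y → ∑ xs (λ x → f x y))
∑-comm []       ys f = sym (∑-0 ys)
∑-comm (x ∷ xs) ys f =
  trans (cong (∑ ys (f x) +_) (∑-comm xs ys f)) (sym (∑-distrib-+ ys (f x) _))

∑-cong : (xs : List A) {f g : A → ℕ} → (∀ x → f x ≡ g x) → ∑ xs f ≡ ∑ xs g
∑-cong []       eq = refl
∑-cong (x ∷ xs) eq = cong₂ _+_ (eq x) (∑-cong xs eq)

∑-mono : (xs : List A) {f g : A → ℕ} → (∀ {x} → x ∈ xs → f x ≤ g x) → ∑ xs f ≤ ∑ xs g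
∑-mono []       le = z≤n
∑-mono (x ∷ xs) le = +-mono-≤ (le (here refl)) (∑-mono xs (le ∘ there))

*-distribˡ-∑ : ∀ c (xs : List A) f → c * ∑ xs f ≡ ∑ xs (λ x → c * f x)
*-distribˡ-∑ c []       f = *-zeroʳ c
*-distribˡ-∑ c (x ∷ xs) f =
  trans (*-distribˡ-+ c (f x) _) (cong (c * f x +_) (*-distribˡ-∑ c xs f))

∑-lowerBound : ∀ {c} (xs : List A) {f} → (∀ {x} → x ∈ xs → c ≤ f x) → length xs * c ≤ ∑ xs f
∑-lowerBound []       le = z≤n
∑-lowerBound (x ∷ xs) le = +-mono-≤ (le (here refl)) (∑-lowerBound xs (le ∘ there))

averaging : ∀ (xs : List A) f b → 0 < length xs → length xs * b ≤ ∑ xs f →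
            ∃[ x ] x ∈ xs × b ≤ f x
averaging (x ∷ xs) f b _ le with b ≤? f x
... | yes b≤fx = x , here refl , b≤fx
averaging (x ∷ []) f b _ le | no b≰fx =
  contradiction (subst₂ _≤_ (+-identityʳ b) (+-identityʳ (f x)) le) b≰fx
averaging (x ∷ y ∷ ys) f b _ le | no b≰fx
  with averaging (y ∷ ys) f b (s≤s z≤n)
         (+-cancelˡ-≤ b _ _ (≤-trans le (+-monoˡ-≤ _ (<⇒≤ (≰⇒> b≰fx)))))
... | z , z∈ , b≤fz = z , there z∈ , b≤fz

count-not : (f : A → Bool) (xs : List A) →
            ∑ xs (χ ∘ f) + ∑ xs (χ ∘ not ∘ f) ≡ length xs
count-not f []       = refl
count-not f (x ∷ xs) with f x
... | true  = cong suc (count-not f xs)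
... | false = trans (+-suc _ _) (cong suc (count-not f xs))

count-filter-¬ : ∀ {p} {P : Pred A p} (P? : Decidable P) (xs : List A) →
  ∑ xs (χ ∘ does ∘ P?) + length (filter (¬? ∘ P?) xs) ≡ length xs
count-filter-¬ P? []       = refl
count-filter-¬ P? (x ∷ xs) with does (P? x)
... | true  = cong suc (count-filter-¬ P? xs)
... | false = trans (+-suc _ _) (cong suc (count-filter-¬ P? xs))

count-false : (f : A → Bool) (xs : List A) → ∑ xs (χ ∘ f) < length xs →
              ∃[ x ] x ∈ xs × f x ≡ false
count-false f (x ∷ xs) lt with f x in fx
... | false = x , here refl , fx
... | true with count-false f xs (s≤s⁻¹ lt)
...   | y , y∈ , fy = y , there y∈ , fy

count-⊎ : (f g h : A → Bool) (xs : List A) →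
          (∀ {x} → x ∈ xs → f x ≡ true → g x ≡ true ⊎ h x ≡ true) →
          ∑ xs (χ ∘ f) ≤ ∑ xs (χ ∘ g) + ∑ xs (χ ∘ h)
count-⊎ f g h xs imp = subst (∑ xs (χ ∘ f) ≤_) (∑-distrib-+ xs _ _) (∑-mono xs pointwise)
  where
  pointwise : ∀ {x} → x ∈ xs → χ (f x) ≤ χ (g x) + χ (h x)
  pointwise {x} x∈ with f x in fx
  ... | false = z≤n
  ... | true with imp x∈ fx
  ...   | inj₁ gx rewrite gx = s≤s z≤n
  ...   | inj₂ hx rewrite hx = m≤n+m 1 (χ (g x))

count-≡ : ∀ q (xs : List ℕ) → Unique xs → ∑ xs (λ x → χ (does (x ≟ q))) ≤ 1
count-≡ q []       _ = z≤n
count-≡ q (x ∷ xs) (x∉ ∷ unique) with x ≟ q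
... | no x≢q rewrite dec-false (x ≟ q) x≢q = count-≡ q xs unique
... | yes refl rewrite dec-true (q ≟ q) refl = s≤s (≤-trans (∑-mono xs absent) (≤-reflexive (∑-0 xs)))
  where
  absent : ∀ {y} → y ∈ xs → χ (does (y ≟ q)) ≤ 0
  absent {y} y∈ rewrite dec-false (y ≟ q) (λ eq → All.lookup x∉ y∈ (sym eq)) = z≤n

-- Choosing a preimage under `g` embeds the elements marked by `f` into those marked by `r`.
count-injection : ∀ (xs ys : List ℕ) (f r : ℕ → Bool) (g : ℕ → ℕ) → Unique xs →
  (∀ {x} → x ∈ xs → f x ≡ true → ∃[ y ] y ∈ ys × r y ≡ true × g y ≡ x) →
  ∑ xs (χ ∘ f) ≤ ∑ ys (χ ∘ r)
count-injection xs [] f r g unique pre = ≤-trans (∑-mono xs none) (≤-reflexive (∑-0 xs))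
  where
  none : ∀ {x} → x ∈ xs → χ (f x) ≤ 0
  none {x} x∈ with f x in fx
  ... | false = z≤n
  ... | true with pre x∈ fx
  ...   | _ , () , _
count-injection xs (y ∷ ys) f r g unique pre with r y in ry
... | false = count-injection xs ys f r g unique tail
  where
  tail : ∀ {x} → x ∈ xs → f x ≡ true → ∃[ z ] z ∈ ys × r z ≡ true × g z ≡ x
  tail x∈ fx with pre x∈ fx
  ... | z , there z∈ , rest     = z , z∈ , rest
  ... | z , here refl , rz , _ = contradiction (trans (sym ry) rz) λ ()
-- `y` accounts for the single value `g y`; `f'` unmarks it and leaves the rest to `ys`.
... | true = ≤-trans (count-⊎ f isgy f' xs cases)
                     (+-mono-≤ (count-≡ (g y) xs unique) (count-injection xs ys f' r g unique tail))
  where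
  isgy f' : ℕ → Bool
  isgy x = does (x ≟ g y)
  f' x = f x ∧ not (isgy x)
  cases : ∀ {x} → x ∈ xs → f x ≡ true → isgy x ≡ true ⊎ f' x ≡ true
  cases {x} _ fx rewrite fx with does (x ≟ g y)
  ... | true  = inj₁ refl
  ... | false = inj₂ refl
  tail : ∀ {x} → x ∈ xs → f' x ≡ true → ∃[ z ] z ∈ ys × r z ≡ true × g z ≡ x
  tail {x} x∈ f'x with f x in fx | x ≟ g y
  tail {x} x∈ f'x | true | yes x≡ rewrite dec-true (x ≟ g y) x≡ = contradiction f'x λ ()
  tail {x} x∈ f'x | true | no x≢ with pre x∈ fx
  ... | z , there z∈ , rest      = z , z∈ , rest
  ... | z , here refl , _ , refl = contradiction refl x≢

-- Excluded middle for finitely many propositions at once holds constructively under a double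
-- negation.
¬¬-decide : (P : ℕ → Set) (xs : List ℕ) →
  ¬ ¬ (∃[ f ] ∀ {x} → x ∈ xs → (f x ≡ true → P x) × (f x ≡ false → ¬ P x))
¬¬-decide P []       k = k ((λ _ → true) , λ ())
¬¬-decide P (x ∷ xs) k = ¬¬-decide P xs λ (f , dec-f) →
  let extend : Dec (P x) → ⊥
      extend d = k (update f d , update-correct f d dec-f)
  in extend (no (λ px → extend (yes px)))
  where
  update : (ℕ → Bool) → Dec (P x) → ℕ → Bool
  update f d y with y ≟ x
  ... | yes _ = does d
  ... | no  _ = f y
  update-correct : ∀ f (d : Dec (P x)) →
    (∀ {y} → y ∈ xs → (f y ≡ true → P y) × (f y ≡ false → ¬ P y)) →
    ∀ {y} → y ∈ x ∷ xs → (update f d y ≡ true → P y) × (update f d y ≡ false → ¬ P y)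
  update-correct f d dec-f {y} y∈ with y ≟ x
  update-correct f (yes px) dec-f y∈         | yes refl = (λ _ → px) , λ ()
  update-correct f (no ¬px) dec-f y∈         | yes refl = (λ ()) , λ _ → ¬px
  update-correct f d dec-f (here y≡x)        | no y≢x   = contradiction y≡x y≢x
  update-correct f d dec-f (there y∈)        | no y≢x   = dec-f y∈

-- Clauses of infinite weight

negCl-⊇ : ∀ E D → All (E ⊆_) (negCl E D)
negCl-⊇ E []      = []
negCl-⊇ E (l ∷ D) = ∈-++⁺ˡ ∷ All.map extend (negCl-⊇ (E ++ [ l ]) D)
  where
  extend : ∀ {C} → E ++ [ l ] ⊆ C → E ⊆ C
  extend ⊆C = ⊆C ∘ ∈-++⁺ˡ

-- A finite weight never becomes infinite, so the clauses of infinite weight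
-- evolve by resolution and weakening alone; the compensation clauses
-- x ∨ A ∨ B̄ and x̄ ∨ B ∨ Ā of a resolution step are mere weakenings.
module InfiniteWeights (G : OrderedAbelianGroup) (Good : Clause → Set)
                       (weaken : ∀ {C D} → C ⊆ D → Good C → Good D) where
  open ResSV G

  GoodIfHard : WClause → Set
  GoodIfHard (C , w) = w ≡ ∞ → Good C

  HardGood : Formula → Set
  HardGood = All GoodIfHard

  -- A condition on the resolvent alone, quantified over all ways to derive it, so that it can be
  -- checked on a bare list of clauses.
  ResolutionGood : Clause → Set
  ResolutionGood C = ∀ x A B → C ≡ A ++ B → Good (pos x ∷ A) → Good (neg x ∷ B) → Good C

  basic : ∀ {F F'} → Basic F F' → HardGood F → HardGood F'
  basic (swap a b R) (p ∷ q ∷ ps) = q ∷ p ∷ ps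
  basic (merge C (fin _) (fin _) R) (p ∷ q ∷ ps) = (λ ()) ∷ ps
  basic (merge C (fin _) ∞ R) (p ∷ q ∷ ps) = q ∷ ps
  basic (merge C ∞ v R) (p ∷ q ∷ ps) = p ∷ ps
  basic (zeroW C R) (p ∷ ps) = ps
  basic (relabel C D w R (C⊆D , _)) (p ∷ ps) = weaken C⊆D ∘ p ∷ ps
  basic (there a b) (p ∷ ps) = p ∷ basic b ps

  -- `≈F` also allows the reverse moves. Splitting an infinite weight only copies the clause, and a
  -- clause inserted with weight 0 is finite.
  basic⁻¹ : ∀ {F F'} → Basic F F' → HardGood F' → HardGood F
  basic⁻¹ (swap a b R) (p ∷ q ∷ ps) = q ∷ p ∷ ps
  basic⁻¹ (merge C (fin _) (fin _) R) (p ∷ ps) = (λ ()) ∷ (λ ()) ∷ ps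
  basic⁻¹ (merge C (fin _) ∞ R) (p ∷ ps) = (λ ()) ∷ p ∷ ps
  basic⁻¹ (merge C ∞ v R) (p ∷ ps) = p ∷ (λ _ → p refl) ∷ ps
  basic⁻¹ (zeroW C R) ps = (λ ()) ∷ ps
  basic⁻¹ (relabel C D w R (_ , D⊆C)) (p ∷ ps) = weaken D⊆C ∘ p ∷ ps
  basic⁻¹ (there a b) (p ∷ ps) = p ∷ basic⁻¹ b ps

  ≈F-resp : ∀ {F F'} → F ≈F F' → HardGood F → HardGood F'
  ≈F-resp ε            ps = ps
  ≈F-resp (fwd b ◅ bs) ps = ≈F-resp bs (basic b ps)
  ≈F-resp (bwd b ◅ bs) ps = ≈F-resp bs (basic⁻¹ b ps)

  dropTaut-hardGood : ∀ {F} → HardGood F → HardGood (dropTaut F)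
  dropTaut-hardGood = All.filter⁺ (λ c → ¬? (tautology? (proj₁ c)))

  withW-fin : ∀ a Cs → HardGood (withW (fin a) Cs)
  withW-fin a Cs = All.map⁺ (All.universal (λ _ ()) Cs)

  withW-good : ∀ {w Cs} → All Good Cs → HardGood (withW w Cs)
  withW-good good = All.map⁺ (All.map (λ g _ → g) good)

  weaken-negCl : ∀ {E} → Good E → ∀ D → All Good (negCl E D)
  weaken-negCl {E} good D = All.map weaken′ (negCl-⊇ E D)
    where
    weaken′ : ∀ {C} → E ⊆ C → Good C
    weaken′ E⊆C = weaken E⊆C good

  resolvents-hardGood : ∀ x A B v w → ResolutionGood (A ++ B) →
    GoodIfHard (pos x ∷ A , v) → GoodIfHard (neg x ∷ B , w) → HardGood (resolvents x A B v w)
  resolvents-hardGood x A B v w res p q = dropTaut-hardGood (go v w p q)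
    where
    rest : Wt → Formula
    rest m = withW m (negCl (pos x ∷ A) B) ++ withW m (negCl (neg x ∷ B) A)
    rest-fin : ∀ a → HardGood (rest (fin a))
    rest-fin a = All.++⁺ (withW-fin a (negCl (pos x ∷ A) B)) (withW-fin a (negCl (neg x ∷ B) A))
    go : ∀ v w → GoodIfHard (pos x ∷ A , v) → GoodIfHard (neg x ∷ B , w) →
         let m = minW v w in
         HardGood ((A ++ B , m) ∷ (pos x ∷ A , v ⊖ m) ∷ (neg x ∷ B , w ⊖ m) ∷ rest m)
    go (fin a) (fin b) p q with compare a b
    ... | tri< _ _ _ = (λ ()) ∷ (λ ()) ∷ (λ ()) ∷ rest-fin a
    ... | tri≈ _ _ _ = (λ ()) ∷ (λ ()) ∷ (λ ()) ∷ rest-fin a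
    ... | tri> _ _ _ = (λ ()) ∷ (λ ()) ∷ (λ ()) ∷ rest-fin b
    go (fin a) ∞ p q = (λ ()) ∷ (λ ()) ∷ q ∷ rest-fin a
    go ∞ (fin b) p q = (λ ()) ∷ p ∷ (λ ()) ∷ rest-fin b
    -- Only when both antecedents are infinite is the minimum, and hence the resolvent, infinite.
    go ∞ ∞ p q =
      (λ _ → res x A B refl (p refl) (q refl)) ∷ p ∷ q ∷
      All.++⁺ (withW-good (weaken-negCl (p refl) B))
              (withW-good (weaken-negCl (q refl) A))

-- The resolvents occurring in a proof

module _ {G : OrderedAbelianGroup} where
  open ResSV G

  -- Split merely weakens and virtual introduces only finite weights, so neither contributes a
  -- clause to be checked.
  resolvent : ∀ {Ant Con} → Rule Ant Con → List Clause
  resolvent (resolution x A B v w _ _) = [ A ++ B ]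
  resolvent (split A w x _)            = []
  resolvent (virtual A a)              = []

  proofResolvents : ∀ {e F F'} → Proof e F F' → List Clause
  proofResolvents done = []
  proofResolvents (step (_ , _ , _ , _ , rule , _) π) = resolvent rule ++ proofResolvents π

  length-proofResolvents : ∀ {e F F'} (π : Proof e F F') → length (proofResolvents π) ≤ e
  length-proofResolvents done = z≤n
  length-proofResolvents (step (_ , _ , _ , _ , resolution _ _ _ _ _ _ _ , _) π) =
    s≤s (length-proofResolvents π)
  length-proofResolvents (step (_ , _ , _ , _ , split _ _ _ _ , _) π) =
    m≤n⇒m≤1+n (length-proofResolvents π)
  length-proofResolvents (step (_ , _ , _ , _ , virtual _ _ , _) π) =
    m≤n⇒m≤1+n (length-proofResolvents π)

  module _ {Good : Clause → Set} (weaken : ∀ {C D} → C ⊆ D → Good C → Good D) where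
    open InfiniteWeights G Good weaken

    rule-hardGood : ∀ {Ant Con} (rule : Rule Ant Con) → All ResolutionGood (resolvent rule) →
                    HardGood Ant → HardGood Con
    rule-hardGood (resolution x A B v w _ _) (res ∷ []) (p ∷ q ∷ []) =
      resolvents-hardGood x A B v w res p q
    rule-hardGood (split A w x _) _ (p ∷ []) = weaken ∈-++⁺ˡ ∘ p ∷ weaken ∈-++⁺ˡ ∘ p ∷ []
    rule-hardGood (virtual A a) _ _ = (λ ()) ∷ (λ ()) ∷ []

    proof-hardGood : ∀ {e F F'} (π : Proof e F F') → All ResolutionGood (proofResolvents π) →
                     HardGood F → HardGood F'
    proof-hardGood done _ good = good
    proof-hardGood (step (Ant , Con , R , F≈ , rule , F'≈) π) res good
      with All.++⁻ (resolvent rule) res | All.++⁻ Ant (≈F-resp F≈ good)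
    ... | res-rule , res-π | good-Ant , good-R =
      proof-hardGood π res-π
        (≈F-resp (Eq.symmetric Basic F'≈) (All.++⁺ (rule-hardGood rule res-rule good-Ant) good-R))

    refutation-good : ∀ {e F} ((F' , π , _) : RefutesIn e F) →
      All ResolutionGood (proofResolvents π) → HardGood F → Good []
    refutation-good (Fe , π , F' , Fe≈ , _ , □∈) res good =
      All.lookup (≈F-resp Fe≈ (proof-hardGood π res good)) □∈ refl

-- Restrictions and critical assignments

pick : ∀ {x : A} {xs} → x ∈ xs → ∃[ ys ] xs ↭ x ∷ ys
pick {x = x} x∈ with ∈-∃++ x∈
... | ys , zs , refl = ys ++ zs , shift x ys zs

∑-↭ : ∀ {xs ys : List A} (f : A → ℕ) → xs ↭ ys → ∑ xs f ≡ ∑ ys f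
∑-↭ f p = sum-↭ (map⁺ f p)

_[_↦_] : (ℕ → ℕ) → ℕ → ℕ → ℕ → ℕ
(g [ j ↦ i ]) k with k ≟ j
... | yes _ = i
... | no  _ = g k

update-≡ : ∀ g j i → (g [ j ↦ i ]) j ≡ i
update-≡ g j i with j ≟ j
... | yes _  = refl
... | no j≢j = contradiction refl j≢j

update-≢ : ∀ g {j i k} → k ≢ j → (g [ j ↦ i ]) k ≡ g k
update-≢ g {j} {i} {k} k≢j with k ≟ j
... | yes k≡j = contradiction k≡j k≢j
... | no _    = refl

-- Pigeons go into holes in list order; as the holes are distinct, no placement overwrites another.
matching : ∀ (ρ : ℕ → ℕ) Q H → Unique H → length Q ≤ length H →
  ∃[ g ] (∀ {j : ℕ} → j ∉ H → g j ≡ ρ j) × (∀ {p : ℕ} → p ∈ Q → ∃[ j ] j ∈ H × g j ≡ p)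
matching ρ []      H       _             _        = ρ , (λ _ → refl) , λ ()
matching ρ (q ∷ Q) (h ∷ H) (h∉ ∷ unique) (s≤s le) =
  let g , outside , hit = matching ρ Q H unique le
  in g [ h ↦ q ] ,
     (λ j∉ → trans (update-≢ g (λ { refl → j∉ (here refl) })) (outside (j∉ ∘ there))) ,
     λ { (here refl) → h , here refl , update-≡ g h q
       ; (there p∈) → let j , j∈ , eq = hit p∈ in
           j , there j∈ , trans (update-≢ g (λ { refl → All.lookup h∉ j∈ refl })) eq }

-- A function g : ℕ → ℕ stands for the assignment putting pigeon g j into hole j.
-- Every hole then holds exactly one pigeon, so the hole clauses are satisfied.
holeOf : Lit → ℕ
holeOf (pos (_ , j)) = j
holeOf (neg (_ , j)) = j

Holds : ℕ → Lit → Set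
Holds p (pos (i , _)) = p ≡ i
Holds p (neg (i , _)) = p ≢ i

holds? : ∀ p l → Dec (Holds p l)
holds? p (pos (i , _)) = p ≟ i
holds? p (neg (i , _)) = ¬? (p ≟ i)

Sat : (ℕ → ℕ) → Clause → Set
Sat g = Any λ l → Holds (g (holeOf l)) l

sat? : ∀ g C → Dec (Sat g C)
sat? g = any? λ l → holds? (g (holeOf l)) l

-- Since exactly one pigeon sits in hole j, x̄_{ij} is equivalent to the disjunction
-- of the x_{i'j} with i' ≢ i; Hits C i j says that x_{ij} occurs in the resulting
-- monotone form of C.
Hits : Clause → ℕ → ℕ → Set
Hits C i j = Any (λ l → holeOf l ≡ j × Holds i l) C

hits? : ∀ C i j → Dec (Hits C i j)
hits? C i j = any? (λ l → (holeOf l ≟ j) ×-dec holds? i l) C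

hits⇒sat : ∀ {C} g j → Hits C (g j) j → Sat g C
hits⇒sat g j = Any.map λ { (refl , h) → h }

-- Only hole `j` changes, so a newly satisfied literal must concern it.
sat-update : ∀ {C} g j i → ¬ Sat g C → Sat (g [ j ↦ i ]) C → Hits C i j
sat-update g j i ¬sat sat with find sat
... | l , l∈ , h with holeOf l ≟ j
...   | yes eq = lose l∈ (eq , h)
...   | no _   = contradiction (lose l∈ h) ¬sat

sat-weaken : ∀ {C D} g → C ⊆ D → Sat g C → Sat g D
sat-weaken g C⊆D sat with find sat
... | l , l∈ , h = lose (C⊆D l∈) h

sat-resolve : ∀ g x A B → Sat g (pos x ∷ A) → Sat g (neg x ∷ B) → Sat g (A ++ B)
sat-resolve g x A B (there satA) _            = Any.++⁺ˡ satA
sat-resolve g x A B (here _)     (there satB) = Any.++⁺ʳ A satB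
sat-resolve g x A B (here eq)    (here neq)   = contradiction eq neq

module _ (m κ : ℕ) where

  -- A partial matching: `P` and `H` are the pigeons and holes still free, and `ρ` gives the pigeon
  -- fixed at every number outside `H`.
  record Restriction : Set where
    field
      P H      : List ℕ
      ρ        : ℕ → ℕ
      P-unique : Unique P
      H-unique : Unique H
      |P|      : length P ≡ suc (length H)
      H⊆holes  : H ⊆ holes m
      covered  : ∀ {p} → p ∈ pigeons m → p ∈ P ⊎ ∃[ j ] j ∈ holes m × j ∉ H × ρ j ≡ p

  open Restriction

  -- Every remaining pigeon but i sits in a remaining hole; that i itself is left
  -- out follows by counting.
  Critical : Restriction → (ℕ → ℕ) → ℕ → Set
  Critical R g i = (∀ {j} → j ∉ H R → g j ≡ ρ R j)
                 × (∀ {p} → p ∈ P R → p ≢ i → ∃[ j ] j ∈ H R × g j ≡ p)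

  -- Such a clause is satisfied by every assignment extending the placements already made.
  Killed : Restriction → Clause → Set
  Killed R C = ∃[ j ] j ∉ H R × Hits C (ρ R j) j

  hitCount : Restriction → Clause → ℕ
  hitCount R C = ∑ (P R) λ i → ∑ (H R) λ j → χ (does (hits? C i j))

  -- The threshold does not depend on R, so that clauses never become wide.
  Wide : Restriction → Clause → Set
  Wide R C = suc m * m ≤ suc κ * hitCount R C

  wide? : ∀ R C → Dec (Wide R C)
  wide? R C = suc m * m ≤? suc κ * hitCount R C

  -- The invariant of the greedy process: each original clause is still listed, already satisfied,
  -- or narrow.
  Status : Restriction → List Clause → Clause → Set
  Status R Cs C = C ∈ Cs ⊎ Killed R C ⊎ ¬ Wide R C

  initial : Restriction
  initial = record
    { P = pigeons m
    ; H = holes m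
    ; ρ = λ _ → 0
    ; P-unique = Unique.map⁺ suc-injective (Unique.upTo⁺ (suc m))
    ; H-unique = Unique.map⁺ suc-injective (Unique.upTo⁺ m)
    ; |P| = trans (length-suc-upTo (suc m)) (cong suc (sym (length-suc-upTo m)))
    ; H⊆holes = λ j∈ → j∈
    ; covered = inj₁
    }
    where
    length-suc-upTo : ∀ n → length (map suc (upTo n)) ≡ n
    length-suc-upTo n = trans (length-map suc (upTo n)) (length-upTo n)

  restrict : ∀ R {i j} → i ∈ P R → j ∈ H R → ∃[ R' ]
    length (H R) ≡ suc (length (H R')) ×
    (∀ {C} → Killed R C → Killed R' C) ×
    (∀ {C} → Hits C i j → Killed R' C) ×
    (∀ C → hitCount R' C ≤ hitCount R C)
  restrict R {i} {j} i∈P j∈H with pick i∈P | pick j∈H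
  ... | P' , P↭ | H' , H↭ = R' , ↭-length H↭ , killed , hit , fewer
    where
    P'-unique : Unique (i ∷ P')
    P'-unique = Unique-resp-↭ (setoid ℕ) (↭⇒↭ₛ P↭) (P-unique R)
    H'-unique : Unique (j ∷ H')
    H'-unique = Unique-resp-↭ (setoid ℕ) (↭⇒↭ₛ H↭) (H-unique R)
    unique-head : ∀ {x : ℕ} {xs} → Unique (x ∷ xs) → x ∉ xs
    unique-head (x∉ ∷ _) x∈ = All.lookup x∉ x∈ refl
    unique-tail : ∀ {x : ℕ} {xs} → Unique (x ∷ xs) → Unique xs
    unique-tail (_ ∷ unique) = unique
    H'⊆H : H' ⊆ H R
    H'⊆H k∈ = ∈-resp-↭ (↭-sym H↭) (there k∈)
    ρ' : ℕ → ℕ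
    ρ' = ρ R [ j ↦ i ]
    ρ'≡ρ : ∀ {k} → k ∉ H R → ρ' k ≡ ρ R k
    ρ'≡ρ k∉ = update-≢ (ρ R) λ { refl → k∉ j∈H }
    covered' : ∀ {p} → p ∈ pigeons m → p ∈ P' ⊎ ∃[ k ] k ∈ holes m × k ∉ H' × ρ' k ≡ p
    covered' p∈ with covered R p∈
    ... | inj₂ (k , k∈ , k∉ , eq) = inj₂ (k , k∈ , k∉ ∘ H'⊆H , trans (ρ'≡ρ k∉) eq)
    ... | inj₁ p∈P with ∈-resp-↭ P↭ p∈P
    ...   | there p∈P' = inj₁ p∈P'
    ...   | here refl  = inj₂ (j , H⊆holes R j∈H , unique-head H'-unique , update-≡ (ρ R) j i)
    R' : Restriction
    R' = record
      { P = P'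
      ; H = H'
      ; ρ = ρ'
      ; P-unique = unique-tail P'-unique
      ; H-unique = unique-tail H'-unique
      ; |P| = suc-injective (trans (sym (↭-length P↭)) (trans (|P| R) (cong suc (↭-length H↭))))
      ; H⊆holes = H⊆holes R ∘ H'⊆H
      ; covered = covered'
      }
    killed : ∀ {C} → Killed R C → Killed R' C
    killed {C} (k , k∉ , h) = k , k∉ ∘ H'⊆H , subst (λ p → Hits C p k) (sym (ρ'≡ρ k∉)) h
    hit : ∀ {C} → Hits C i j → Killed R' C
    hit {C} h = j , unique-head H'-unique , subst (λ p → Hits C p j) (sym (update-≡ (ρ R) j i)) h
    fewer : ∀ C → hitCount R' C ≤ hitCount R C
    fewer C = begin
      ∑ P' (λ p → ∑ H' (h p))        ≤⟨ ∑-mono P' (λ {p} _ → m≤n+m (∑ H' (h p)) (h p j)) ⟩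
      ∑ P' (λ p → ∑ (j ∷ H') (h p))  ≡⟨ ∑-cong P' (λ p → ∑-↭ (h p) H↭) ⟨
      ∑ P' (λ p → ∑ (H R) (h p))     ≤⟨ m≤n+m _ (∑ (H R) (h i)) ⟩
      ∑ (i ∷ P') (λ p → ∑ (H R) (h p)) ≡⟨ ∑-↭ _ P↭ ⟨
      hitCount R C                   ∎
      where
      open ≤-Reasoning
      h : ℕ → ℕ → ℕ
      h p k = χ (does (hits? C p k))

  -- Greedy elimination of wide clauses

  -- Double counting of triples (pigeon, hole, clause), then averaging first over pigeons and then
  -- over holes. There are at most `suc m * m` pairs, the quantity in the width threshold.
  popular : ∀ R Cs {h} → length (H R) ≡ suc h → suc h ≤ m → All (Wide R) Cs →
    ∃[ i ] ∃[ j ] i ∈ P R × j ∈ H R × length Cs ≤ suc κ * ∑ Cs (λ C → χ (does (hits? C i j)))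
  popular R Cs {h} |H| h≤ wide =
    let i , i∈ , le-i = averaging (P R) (λ i → ∑ (H R) λ j → hits i j) (length (H R) * length Cs)
                          (subst (0 <_) (sym (|P| R)) (s≤s z≤n)) total
        j , j∈ , le-j = averaging (H R) (hits i) (length Cs) (subst (0 <_) (sym |H|) (s≤s z≤n)) le-i
    in i , j , i∈ , j∈ , le-j
    where
    open ≤-Reasoning
    hits : ℕ → ℕ → ℕ
    hits i j = suc κ * ∑ Cs λ C → χ (does (hits? C i j))
    area : length (P R) * length (H R) ≤ suc m * m
    area rewrite |P| R | |H| = *-mono-≤ (s≤s h≤) h≤
    doubleCount : ∑ (P R) (λ i → ∑ (H R) λ j → ∑ Cs λ C → χ (does (hits? C i j))) ≡ ∑ Cs (hitCount R)
    doubleCount = trans (∑-cong (P R) λ i → ∑-comm (H R) Cs _) (∑-comm (P R) Cs _)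
    total : length (P R) * (length (H R) * length Cs) ≤ ∑ (P R) (λ i → ∑ (H R) λ j → hits i j)
    total = begin
      length (P R) * (length (H R) * length Cs)  ≡⟨ *-assoc (length (P R)) _ _ ⟨
      length (P R) * length (H R) * length Cs    ≤⟨ *-monoˡ-≤ (length Cs) area ⟩
      suc m * m * length Cs                      ≡⟨ *-comm (suc m * m) (length Cs) ⟩
      length Cs * (suc m * m)                    ≤⟨ ∑-lowerBound Cs (All.lookup wide) ⟩
      ∑ Cs (λ C → suc κ * hitCount R C)          ≡⟨ *-distribˡ-∑ (suc κ) Cs (hitCount R) ⟨
      suc κ * ∑ Cs (hitCount R)                  ≡⟨ cong (suc κ *_) doubleCount ⟨
      suc κ * ∑ (P R) (λ i → ∑ (H R) λ j → ∑ Cs λ C → χ (does (hits? C i j)))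
                                                 ≡⟨ *-distribˡ-∑ (suc κ) (P R) _ ⟩
      ∑ (P R) (λ i → suc κ * ∑ (H R) λ j → ∑ Cs λ C → χ (does (hits? C i j)))
                                                 ≡⟨ ∑-cong (P R) (λ i → *-distribˡ-∑ (suc κ) (H R) _) ⟩
      ∑ (P R) (λ i → ∑ (H R) λ j → hits i j)     ∎

  greedyStep : ∀ R Cs {h} → length (H R) ≡ suc h → suc h ≤ m → ∃[ R' ] ∃[ Cs' ]
    length (H R') ≡ h × suc κ * length Cs' ≤ κ * length Cs ×
    (∀ {C} → Status R Cs C → Status R' Cs' C)
  greedyStep R Cs {h} |H| h≤
    with i , j , i∈ , j∈ , many ← popular R (filter (wide? R) Cs) |H| h≤ (All.all-filter (wide? R) Cs)
    with R' , |H'| , killed , hit , fewer ← restrict R i∈ j∈ =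
    R' , filter missed? Wides , suc-injective (trans (sym |H'|) |H|) ,
    ≤-trans (shrink κ (count-filter-¬ (λ C → hits? C i j) Wides) many)
            (*-monoʳ-≤ κ (length-filter (wide? R) Cs)) ,
    status
    where
    Wides : List Clause
    Wides = filter (wide? R) Cs
    missed? : ∀ C → Dec (¬ Hits C i j)
    missed? C = ¬? (hits? C i j)
    -- At least one part in `suc k` is hit, so at most `k` parts in `suc k` are missed.
    shrink : ∀ k {a b n} → a + b ≡ n → n ≤ suc k * a → suc k * b ≤ k * n
    shrink k {a} {b} refl le = +-cancelˡ-≤ (suc k * a) _ _ (begin
      suc k * a + suc k * b          ≡⟨ *-distribˡ-+ (suc k) a b ⟨
      suc k * (a + b)                ≤⟨ +-monoˡ-≤ (k * (a + b)) le ⟩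
      suc k * a + k * (a + b)        ∎)
      where open ≤-Reasoning
    stillNarrow : ∀ C → ¬ Wide R C → ¬ Wide R' C
    stillNarrow C narrow wide = narrow (≤-trans wide (*-monoʳ-≤ (suc κ) (fewer C)))
    status : ∀ {C} → Status R Cs C → Status R' (filter missed? Wides) C
    status {C} (inj₂ (inj₁ k))      = inj₂ (inj₁ (killed k))
    status {C} (inj₂ (inj₂ narrow)) = inj₂ (inj₂ (stillNarrow C narrow))
    status {C} (inj₁ C∈) with wide? R C | hits? C i j
    ... | no narrow | _       = inj₂ (inj₂ (stillNarrow C narrow))
    ... | yes _     | yes hC  = inj₂ (inj₁ (hit hC))
    ... | yes wide  | no miss = inj₁ (∈-filter⁺ missed? (∈-filter⁺ (wide? R) C∈ wide) miss)

  greedy : ∀ t {n} R Cs → length (H R) ≡ t + n → t + n ≤ m → ∃[ R' ] ∃[ Cs' ]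
    length (H R') ≡ n × suc κ ^ t * length Cs' ≤ κ ^ t * length Cs ×
    (∀ {C} → Status R Cs C → Status R' Cs' C)
  greedy zero    R Cs |H| _  = R , Cs , |H| , ≤-refl , λ s → s
  greedy (suc t) R Cs |H| le =
    let R₁ , Cs₁ , |H₁| , le₁ , status₁ = greedyStep R Cs |H| le
        R₂ , Cs₂ , |H₂| , le₂ , status₂ = greedy t R₁ Cs₁ |H₁| (<⇒≤ le)
    in R₂ , Cs₂ , |H₂| , chain (suc κ ^ t) (κ ^ t) le₁ le₂ , status₂ ∘ status₁
    where
    chain : ∀ {x y z} a b → suc κ * y ≤ κ * x → a * z ≤ b * y → suc κ * a * z ≤ κ * b * x
    chain {x} {y} {z} a b le₁ le₂ = begin
      suc κ * a * z      ≡⟨ *-assoc (suc κ) a z ⟩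
      suc κ * (a * z)    ≤⟨ *-monoʳ-≤ (suc κ) le₂ ⟩
      suc κ * (b * y)    ≡⟨ commute (suc κ) b y ⟩
      b * (suc κ * y)    ≤⟨ *-monoʳ-≤ b le₁ ⟩
      b * (κ * x)    ≡⟨ commute b κ x ⟩
      κ * (b * x)    ≡⟨ *-assoc κ b x ⟨
      κ * b * x      ∎
      where
      open ≤-Reasoning
      commute : ∀ p q r → p * (q * r) ≡ q * (p * r)
      commute = solve-∀

  -- Critical assignments and falsifiable pigeons

  critical-exists : ∀ R {i} → i ∈ P R → ∃[ g ] Critical R g i
  critical-exists R {i} i∈ =
    let Q , P↭ = pick i∈
        g , outside , hit = matching (ρ R) Q (H R) (H-unique R)
                              (≤-reflexive (suc-injective (trans (sym (↭-length P↭)) (|P| R))))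
    in g , outside , λ p∈ p≢i → hit (tail (∈-resp-↭ P↭ p∈) p≢i)
    where
    tail : ∀ {p Q} → p ∈ i ∷ Q → p ≢ i → p ∈ Q
    tail (here p≡i) p≢i = contradiction p≡i p≢i
    tail (there p∈) _   = p∈

  -- The left-out pigeon `i` takes hole `j` and displaces `i'`; every other pigeon keeps its hole.
  critical-move : ∀ R {g i i' j} → Critical R g i → j ∈ H R → g j ≡ i' →
                  Critical R (g [ j ↦ i ]) i'
  critical-move R {g} {i} {i'} {j} (outside , hit) j∈ gj = outside' , hit'
    where
    outside' : ∀ {k} → k ∉ H R → (g [ j ↦ i ]) k ≡ ρ R k
    outside' k∉ = trans (update-≢ g (λ { refl → k∉ j∈ })) (outside k∉)
    hit' : ∀ {p} → p ∈ P R → p ≢ i' → ∃[ k ] k ∈ H R × (g [ j ↦ i ]) k ≡ p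
    hit' {p} p∈ p≢i' with p ≟ i
    ... | yes refl = j , j∈ , update-≡ g j i
    ... | no p≢i with hit p∈ p≢i
    ...   | k , k∈ , gk = k , k∈ , trans (update-≢ g (λ { refl → p≢i' (trans (sym gk) gj) })) gk

  Falsifiable : Restriction → Clause → ℕ → Set
  Falsifiable R C i = ∃[ g ] Critical R g i × ¬ Sat g C

  -- Moving i, unmatched in a falsifying assignment, into the hole of a pigeon p that
  -- is not falsifiable satisfies C, so C is hit at i and that hole.
  hitCount-lowerBound : ∀ R C (f : ℕ → Bool) →
    (∀ {i} → i ∈ P R → (f i ≡ true → Falsifiable R C i) × (f i ≡ false → ¬ Falsifiable R C i)) →
    ∑ (P R) (χ ∘ f) * ∑ (P R) (χ ∘ not ∘ f) ≤ hitCount R C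
  hitCount-lowerBound R C f dec = begin
    ∑ (P R) (χ ∘ f) * b               ≡⟨ *-comm _ b ⟩
    b * ∑ (P R) (χ ∘ f)               ≡⟨ *-distribˡ-∑ b (P R) (χ ∘ f) ⟩
    ∑ (P R) (λ i → b * χ (f i))       ≤⟨ ∑-mono (P R) row ⟩
    hitCount R C                      ∎
    where
    open ≤-Reasoning
    b : ℕ
    b = ∑ (P R) (χ ∘ not ∘ f)
    row : ∀ {i} → i ∈ P R → b * χ (f i) ≤ ∑ (H R) (λ j → χ (does (hits? C i j)))
    row {i} i∈ with f i in fi
    ... | false = ≤-trans (≤-reflexive (*-zeroʳ b)) z≤n
    ... | true with proj₁ (dec i∈) fi
    ...   | g , crit , ¬sat = ≤-trans (≤-reflexive (*-identityʳ b))
              -- The non-falsifiable pigeons occupy distinct holes under `g`, so row `i` contains at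
              -- least `b` hits.
              (count-injection (P R) (H R) (not ∘ f) (λ j → does (hits? C i j)) g (P-unique R) source)
      where
      source : ∀ {p} → p ∈ P R → not (f p) ≡ true → ∃[ j ] j ∈ H R × does (hits? C i j) ≡ true × g j ≡ p
      source {p} p∈ _ with f p in fp
      source {p} p∈ _ | false with proj₂ crit p∈ (λ { refl → contradiction (trans (sym fi) fp) λ () })
      ... | j , j∈ , gj = j , j∈ , dec-true (hits? C i j) (sat-update g j i ¬sat sat') , gj
        where
        sat' : Sat (g [ j ↦ i ]) C
        sat' = decidable-stable (sat? (g [ j ↦ i ]) C) λ ¬sat' →
          proj₂ (dec p∈) fp (g [ j ↦ i ] , critical-move R crit j∈ gj , ¬sat')

  -- Easy clauses and their preservation under resolution

  module _ (R : Restriction) {n : ℕ} (|H| : length (H R) ≡ n) where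

    -- `f` need only contain the falsifiable pigeons, so the property passes to weaker clauses.
    FewFalsifiable : Clause → Set
    FewFalsifiable C = ∃[ f ] 3 * ∑ (P R) (χ ∘ f) ≤ n ×
      (∀ {i} → i ∈ P R → f i ≡ false → ∀ g → Critical R g i → Sat g C)

    -- The double negation makes it possible to decide which pigeons are falsifiable.
    Easy : Clause → Set
    Easy C = ¬ ¬ FewFalsifiable C

    easy-weaken : ∀ {C D} → C ⊆ D → Easy C → Easy D
    easy-weaken C⊆D easy k =
      easy λ (f , few , sat) → k (f , few , λ i∈ fi g crit → sat-weaken g C⊆D (sat i∈ fi g crit))

    satisfied-easy : ∀ {C} → (∀ {i} → i ∈ P R → ∀ g → Critical R g i → Sat g C) → Easy C
    satisfied-easy sat k = k ((λ _ → false) ,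
      ≤-trans (≤-reflexive (cong (3 *_) (∑-0 (P R)))) z≤n , λ i∈ _ → sat i∈)

    -- At most n/3 of the n + 1 pigeons are marked, so some pigeon is unmarked, and a critical
    -- assignment leaving it out would have to satisfy □.
    ¬easy-□ : ¬ Easy []
    ¬easy-□ easy = easy λ (f , few , sat) →
      let i , i∈ , fi = count-false f (P R)
            (subst (∑ (P R) (χ ∘ f) <_) (sym (trans (|P| R) (cong suc |H|))) (s≤s (≤-trans (m≤n*m _ 3) few)))
          g , crit = critical-exists R i∈
      in contradiction (sat i∈ fi g crit) λ ()

    -- The clause of a placed pigeon always holds; that of a free pigeon can fail only when this
    -- pigeon is left out, and one pigeon is at most n/3.
    easy-pigeonClause : 3 ≤ n → ∀ {p} → p ∈ pigeons m → Easy (pigeonClause m p)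
    easy-pigeonClause 3≤n {p} p∈ with covered R p∈
    ... | inj₂ (j , j∈ , j∉ , eq) = satisfied-easy λ _ g crit →
      lose (∈-map⁺ (λ j → pos (p , j)) j∈) (trans (proj₁ crit j∉) eq)
    ... | inj₁ p∈P = λ k → k ((λ i → does (i ≟ p)) ,
      ≤-trans (*-monoʳ-≤ 3 (count-≡ p (P R) (P-unique R))) 3≤n , sat)
      where
      sat : ∀ {i} → i ∈ P R → does (i ≟ p) ≡ false → ∀ g → Critical R g i → Sat g (pigeonClause m p)
      sat {i} i∈ i≢p g (_ , hit)
        with hit p∈P (λ { refl → contradiction (trans (sym (dec-true (i ≟ i) refl)) i≢p) λ () })
      ... | j , j∈ , gj = lose (∈-map⁺ (λ j → pos (p , j)) (H⊆holes R j∈)) gj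

    easy-holeClauses : All Easy (holeClauses m)
    easy-holeClauses = All.concat⁺ (All.map⁺ (All.universal (λ j →
      All.concat⁺ (All.map⁺ (All.universal (λ i →
        All.map⁺ (All.universal (λ k → satisfied-easy λ _ g _ → satisfied g i j k)
          (upTo (suc m ∸ i)))) (pigeons m)))) (holes m)))
      where
      satisfied : ∀ g i j k → Sat g (neg (i , j) ∷ neg (i + suc k , j) ∷ [])
      satisfied g i j k with g j ≟ i
      ... | no gj≢i  = here gj≢i
      ... | yes refl = there (here (m≢1+m+n (g j) ∘ λ eq → trans eq (+-suc (g j) k)))

    easy-K : 3 ≤ n → All Easy (K m)
    easy-K 3≤n = All.++⁺ (All.map⁺ (All.tabulate (easy-pigeonClause 3≤n))) easy-holeClauses

    -- Here 3a ≥ n + 1, and a ≤ c + d ≤ 2n/3 leaves 3b ≥ n + 1, so 9ab ≥ (n + 1)².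
    balanced : ∀ {a b} c d → 9 * (suc m * m) ≤ suc κ * (suc n * suc n) → a + b ≡ suc n → ¬ 3 * a ≤ n →
      3 * c ≤ n → 3 * d ≤ n → a ≤ c + d → suc m * m ≤ suc κ * (a * b)
    balanced {a} {b} c d area a+b 3a≰n 3c≤n 3d≤n a≤c+d = *-cancelˡ-≤ 9 (begin
      9 * (suc m * m)                ≤⟨ area ⟩
      suc κ * (suc n * suc n)        ≤⟨ *-monoʳ-≤ (suc κ) (*-mono-≤ (≰⇒> 3a≰n) n<3b) ⟩
      suc κ * (3 * a * (3 * b))      ≡⟨ regroup (suc κ) a b ⟩
      9 * (suc κ * (a * b))          ∎)
      where
      open ≤-Reasoning
      regroup : ∀ k a b → k * (3 * a * (3 * b)) ≡ 9 * (k * (a * b))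
      regroup = solve-∀
      threeN : ∀ n → n + n + suc n + 2 ≡ 3 * suc n
      threeN = solve-∀
      n<3b : suc n ≤ 3 * b
      n<3b = +-cancelˡ-≤ (3 * a) _ _ (begin
        3 * a + suc n              ≤⟨ +-monoˡ-≤ (suc n) (*-monoʳ-≤ 3 a≤c+d) ⟩
        3 * (c + d) + suc n        ≡⟨ cong (_+ suc n) (*-distribˡ-+ 3 c d) ⟩
        3 * c + 3 * d + suc n      ≤⟨ +-monoˡ-≤ (suc n) (+-mono-≤ 3c≤n 3d≤n) ⟩
        n + n + suc n              ≤⟨ m≤m+n _ 2 ⟩
        n + n + suc n + 2          ≡⟨ threeN n ⟩
        3 * suc n                  ≡⟨ cong (3 *_) a+b ⟨
        3 * (a + b)                ≡⟨ *-distribˡ-+ 3 a b ⟩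
        3 * a + 3 * b              ∎)

    -- By soundness, a pigeon falsifiable for the resolvent is marked for one of the premises. More
    -- than n/3 such pigeons would thus be at most 2n/3, and the clause would be wide.
    easy-resolve : 9 * (suc m * m) ≤ suc κ * (suc n * suc n) → ∀ {C} → Killed R C ⊎ ¬ Wide R C →
      ∀ x A B → C ≡ A ++ B → Easy (pos x ∷ A) → Easy (neg x ∷ B) → Easy C
    easy-resolve area {C} (inj₁ (j , j∉ , h)) x A B _ _ _ = satisfied-easy λ _ g crit →
      hits⇒sat g j (subst (λ p → Hits C p j) (sym (proj₁ crit j∉)) h)
    easy-resolve area (inj₂ ¬wide) x A B refl easyA easyB k =
      easyA λ (f , few-f , sat-f) → easyB λ (g , few-g , sat-g) →
      ¬¬-decide (Falsifiable R (A ++ B)) (P R) λ (w , dec) →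
      let falsifiable : ∀ {i} → i ∈ P R → w i ≡ true → f i ≡ true ⊎ g i ≡ true
          falsifiable {i} i∈ wi = falsified (f i) (g i) refl refl
            (sat-f i∈) (sat-g i∈) (proj₁ (dec i∈) wi)
          wide : ¬ 3 * ∑ (P R) (χ ∘ w) ≤ n → Wide R (A ++ B)
          wide many = ≤-trans
            (balanced (∑ (P R) (χ ∘ f)) (∑ (P R) (χ ∘ g)) area (trans (count-not w (P R)) (trans (|P| R) (cong suc |H|))) many few-f few-g
                      (count-⊎ w f g (P R) falsifiable))
            (*-monoʳ-≤ (suc κ) (hitCount-lowerBound R (A ++ B) w dec))
      -- If the falsifiable pigeons were few, `w` would show the clause easy, against `k`; hence
      -- they are many.
      in ¬wide (wide λ few → k (w , few , λ i∈ wi g crit →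
           decidable-stable (sat? g (A ++ B)) λ ¬sat → proj₂ (dec i∈) wi (g , crit , ¬sat)))
      where
      falsified : ∀ {i} (s t : Bool) {s' t' : Bool} → s' ≡ s → t' ≡ t →
        (s' ≡ false → ∀ g → Critical R g i → Sat g (pos x ∷ A)) →
        (t' ≡ false → ∀ g → Critical R g i → Sat g (neg x ∷ B)) →
        Falsifiable R (A ++ B) i → s' ≡ true ⊎ t' ≡ true
      falsified true  _     eq _  _ _ _ = inj₁ eq
      falsified false true  _  eq _ _ _ = inj₂ eq
      falsified false false s≡ t≡ satA satB (g , crit , ¬sat) =
        contradiction (sat-resolve g x A B (satA s≡ g crit) (satB t≡ g crit)) ¬sat

-- The exponential lower bound

refutation-length : ∀ G n {e} → 3 ≤ n → 35 ^ n * e < 36 ^ n →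
                    ¬ ResSV.RefutesIn G e (ResSV.PHP G (2 * n))
refutation-length G n {e} 3≤n short refutation@(_ , π , _) =
  let R , Cs , |H| , le , status = greedy m 35 n (initial m 35) Rs |holes| (≤-reflexive n+n≡m)
      none : ∀ {C} → C ∉ Cs
      -- A surviving clause would give 36 ^ n ≤ 35 ^ n * e.
      none C∈ = <⇒≱ short (bound le (∈-length C∈))
      notListed : ∀ {C} → Status m 35 R Cs C → Killed m 35 R C ⊎ ¬ Wide m 35 R C
      notListed = λ { (inj₁ C∈) → contradiction C∈ none ; (inj₂ s) → s }
  in ¬easy-□ m 35 R |H|
       (refutation-good {Good = Easy m 35 R |H|} (easy-weaken m 35 R |H|) refutation
         (All.tabulate λ C∈ → easy-resolve m 35 R |H| area (notListed (status (inj₁ C∈))))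
         (All.map⁺ (All.map (λ easy _ → easy) (easy-K m 35 R |H| 3≤n))))
  where
  open ≤-Reasoning
  m : ℕ
  m = 2 * n
  Rs : List Clause
  Rs = proofResolvents π
  n+n≡m : n + n ≡ m
  n+n≡m = cong (n +_) (sym (+-identityʳ n))
  |holes| : length (holes m) ≡ n + n
  |holes| = trans (trans (length-map suc (upTo m)) (length-upTo m)) (sym n+n≡m)
  ∈-length : ∀ {C : Clause} {Cs} → C ∈ Cs → 1 ≤ length Cs
  ∈-length (here _)  = s≤s z≤n
  ∈-length (there _) = s≤s z≤n
  bound : ∀ {l} → 36 ^ n * l ≤ 35 ^ n * length Rs → 1 ≤ l → 36 ^ n ≤ 35 ^ n * e
  bound {l} le 1≤l = begin
    36 ^ n                ≡⟨ *-identityʳ (36 ^ n) ⟨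
    36 ^ n * 1            ≤⟨ *-monoʳ-≤ (36 ^ n) 1≤l ⟩
    36 ^ n * l            ≤⟨ le ⟩
    35 ^ n * length Rs    ≤⟨ *-monoʳ-≤ (35 ^ n) (length-proofResolvents π) ⟩
    35 ^ n * e            ∎
  -- This fixes 36 = 9 * 4: the two thirds bounds cost 9, and halving the number of holes costs 4.
  area : 9 * (suc m * m) ≤ 36 * (suc n * suc n)
  area = begin
    9 * (suc (2 * n) * (2 * n))                    ≤⟨ m≤m+n _ (54 * n + 36) ⟩
    9 * (suc (2 * n) * (2 * n)) + (54 * n + 36)    ≡⟨ square n ⟩
    36 * (suc n * suc n)                           ∎
    where
    square : ∀ n → 9 * (suc (2 * n) * (2 * n)) + (54 * n + 36) ≡ 36 * (suc n * suc n)
    square = solve-∀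

theorem11 : (G : OrderedAbelianGroup) → ¬ ResSV.PolynomialPHPProofs G
theorem11 G (c , k , proofs) = short-proof (exponential-beats-polynomial c k)
  where
  short-proof : ¬ (∃[ n ] 3 ≤ n × 35 ^ n * (c * (2 * n) ^ k + c) < 36 ^ n)
  short-proof (n , 3≤n , beats) with proofs (2 * n) (≤-trans (≤-trans (s≤s z≤n) 3≤n) (m≤n*m n 2))
  ... | e , e≤ , refutation =
    refutation-length G n 3≤n (≤-<-trans (*-monoʳ-≤ (35 ^ n) e≤) beats) refutation
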